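{- For all integers $k,n$ with $6 \le k \le n$ the following inequalities hold: (i) $\mathrm{sat}(k,k)\le \frac{15}{16}\,2^{k-1}$; (ii) $\mathrm{wsat}(n,k) = O\!\left(\frac{\log k}{k}2^k\right)$, where the implied constant is absolute (independent of $n$ and $k$).
   Context: Write $[n]=\{1,\dots,n\}$ and let $2^{[n]}$ be its power set. For positive integers $k,n$ and a family $\mathcal F\subseteq 2^{[n]}$ consider the two properties: (1) there do not exist $k+1$ distinct sets $F_1,\dots,F_{k+1}\in\mathcal F$ forming a $(k+1)$-chain $F_1\subset F_2\subset\dots\subset F_{k+1}$; (2) for every $S\in 2^{[n]}\setminus\mathcal F$ there exist $k$ distinct sets $F_1,\dots,F_k\in\mathcal F$ such that $S$ together with $F_1,\dots,F_k$ forms a $(k+1)$-chain (i.e. these $k+1$ distinct sets are totally ordered by inclusion). The family $\mathcal F$ is weakly saturating $k$-Sperner if it satisfies (2), and (strongly) saturating $k$-Sperner if it satisfies both (1) and (2). Let $\mathrm{sat}(n,k)$ (respectively $\mathrm{wsat}(n,k)$) denote the minimum number of sets in a strongly saturating (respectively weakly saturating) $k$-Sperner family $\mathcal F\subseteq 2^{[n]}$. -}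

module Defs where

open import Data.Bool.Properties using () renaming (_≟_ to _≟ᵇ_)
open import Data.Empty using (⊥-elim)
open import Data.Fin.Subset using (Subset; inside; outside; _⊂_)
open import Data.Fin.Subset.Properties using (_⊂?_; anySubset?; ⊂-irref; ⊂-trans)
open import Data.List using (List; []; _∷_; _++_) renaming (map to mapˡ)
import Data.List.Membership.Propositional as ListMem
open import Data.List.Membership.Propositional.Properties using (∈-map⁺; ∈-++⁺ˡ; ∈-++⁺ʳ)
import Data.List.Relation.Unary.Any as ListAny
open import Data.Nat using (ℕ; zero; suc; _≤_; _<_)
open import Data.Nat.Induction using (<-wellFounded)
open import Data.Nat.Properties using (anyUpTo?; ≮⇒≥)
open import Data.Product using (∃; ∃-syntax; Σ-syntax; _×_; _,_; proj₁; proj₂)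
open import Data.Sum using (_⊎_; inj₁; inj₂; swap)
open import Data.Vec using (Vec; []; _∷_)
open import Data.Vec.Membership.Propositional using (_∈_; _∉_)
import Data.Vec.Membership.DecPropositional as DecMem
open import Data.Vec.Properties using (≡-dec)
open import Data.Vec.Relation.Unary.All as All using (All; []; _∷_; all?)
open import Data.Vec.Relation.Unary.AllPairs using (AllPairs; []; _∷_; allPairs?)
open import Data.Vec.Relation.Unary.Any using (here; there)
open import Data.Vec.Relation.Unary.Linked using (Linked; []; [-]; _∷_; linked?)
open import Data.Vec.Relation.Unary.Linked.Properties using (Linked⇒All)
open import Data.Vec.Relation.Unary.Unique.Propositional using (Unique)
open import Induction.WellFounded using (Acc; acc)
open import Level using (0ℓ)
open import Relation.Binary.Definitions using (DecidableEquality)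
open import Relation.Binary.PropositionalEquality using (_≡_; refl)
open import Relation.Nullary using (¬_; Dec; yes; no; ¬?)
open import Relation.Nullary.Decidable using (map′; _×-dec_; _⊎-dec_; _→-dec_; decidable-stable)
open import Relation.Unary using (Pred; Decidable)

private
  variable
    n k m : ℕ

-- A family of m subsets of [n] is a vector F : Vec (Subset n) m whose entries
-- are pairwise distinct (Unique F).

-- Distinct and comparable under inclusion (_⊂_ is proper inclusion).
Comparable : Subset n → Subset n → Set
Comparable A B = A ⊂ B ⊎ B ⊂ A

TotallyOrdered : Vec (Subset n) m → Set
TotallyOrdered = AllPairs Comparable

-- The index k forbids chains of length k + 1.
ChainFree : ℕ → Vec (Subset n) m → Set
ChainFree {n} k F = ¬ (Σ[ C ∈ Vec (Subset n) (suc k) ] All (_∈ F) C × Linked _⊂_ C)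

-- S is not an entry of Fs, since Comparable is irreflexive, so S together with
-- the entries of Fs is a chain of length k + 1.
Completes : (k : ℕ) → Vec (Subset n) m → Subset n → Set
Completes {n} k F S = Σ[ Fs ∈ Vec (Subset n) k ] All (_∈ F) Fs × TotallyOrdered (S ∷ Fs)

WeaklySaturating : ℕ → Vec (Subset n) m → Set
WeaklySaturating {n} k F = (S : Subset n) → S ∉ F → Completes k F S

StronglySaturating : ℕ → Vec (Subset n) m → Set
StronglySaturating k F = ChainFree k F × WeaklySaturating k F

WeakSize : ℕ → ℕ → Pred ℕ 0ℓ
WeakSize n k m = Σ[ F ∈ Vec (Subset n) m ] Unique F × WeaklySaturating k F

StrongSize : ℕ → ℕ → Pred ℕ 0ℓ
StrongSize n k m = Σ[ F ∈ Vec (Subset n) m ] Unique F × StronglySaturating k F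

IsMinimum : Pred ℕ 0ℓ → Pred ℕ 0ℓ
IsMinimum P m = P m × (∀ l → P l → m ≤ l)

-- The remainder shows that both minima exist, for all n and k.

least : {P : Pred ℕ 0ℓ} → Decidable P → ∃ P → ∃ (IsMinimum P)
least {P} P? (m , p) = go m p (<-wellFounded m)
  where
  go : ∀ m → P m → Acc _<_ m → ∃ (IsMinimum P)
  go m p (acc rs) with anyUpTo? P? m
  ... | yes (l , l<m , q) = go l q (rs l<m)
  ... | no none = m , p , λ l q → ≮⇒≥ (λ l<m → none (l , l<m , q))

_≟ˢ_ : DecidableEquality (Subset n)
_≟ˢ_ = ≡-dec _≟ᵇ_

_∈?_ : (S : Subset n) (F : Vec (Subset n) m) → Dec (S ∈ F)
S ∈? F = DecMem._∈?_ _≟ˢ_ S F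

anyVec? : ∀ m {P : Pred (Vec (Subset n) m) 0ℓ} → Decidable P → Dec (∃ P)
anyVec? zero P? = map′ (λ p → [] , p) (λ { ([] , p) → p }) (P? [])
anyVec? (suc m) P? = map′
  (λ { (S , F , p) → S ∷ F , p })
  (λ { (S ∷ F , p) → S , F , p })
  (anySubset? (λ S → anyVec? m (λ F → P? (S ∷ F))))

allSubset? : {P : Pred (Subset n) 0ℓ} → Decidable P → Dec (∀ S → P S)
allSubset? P? = map′
  (λ none S → decidable-stable (P? S) (λ ¬p → none (S , ¬p)))
  (λ all (S , ¬p) → ¬p (all S))
  (¬? (anySubset? (λ S → ¬? (P? S))))

comparable? : (A B : Subset n) → Dec (Comparable A B)
comparable? A B = (A ⊂? B) ⊎-dec (B ⊂? A)

chainFree? : ∀ k (F : Vec (Subset n) m) → Dec (ChainFree k F)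
chainFree? k F = ¬? (anyVec? (suc k) (λ C → all? (_∈? F) C ×-dec linked? _⊂?_ C))

completes? : ∀ k (F : Vec (Subset n) m) S → Dec (Completes k F S)
completes? k F S =
  anyVec? k (λ Fs → all? (_∈? F) Fs ×-dec allPairs? comparable? (S ∷ Fs))

weaklySaturating? : ∀ k (F : Vec (Subset n) m) → Dec (WeaklySaturating k F)
weaklySaturating? k F = allSubset? (λ S → ¬? (S ∈? F) →-dec completes? k F S)

unique? : (F : Vec (Subset n) m) → Dec (Unique F)
unique? = allPairs? (λ A B → ¬? (A ≟ˢ B))

weakSize? : ∀ n k → Decidable (WeakSize n k)
weakSize? n k m = anyVec? m (λ F → unique? F ×-dec weaklySaturating? k F)

strongSize? : ∀ n k → Decidable (StrongSize n k)
strongSize? n k m =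
  anyVec? m (λ F → unique? F ×-dec (chainFree? k F ×-dec weaklySaturating? k F))

Comparable-irrefl : {S : Subset n} → ¬ Comparable S S
Comparable-irrefl (inj₁ S⊂S) = ⊂-irref refl S⊂S
Comparable-irrefl (inj₂ S⊂S) = ⊂-irref refl S⊂S

-- A chain in S ∷ F either lies in F, or splits into S and a chain Fs in F.
split : (S : Subset n) (F : Vec (Subset n) m) (C : Vec (Subset n) (suc k)) →
        All (_∈ (S ∷ F)) C → TotallyOrdered C →
        All (_∈ F) C ⊎
        (Σ[ Fs ∈ Vec (Subset n) k ] All (_∈ F) Fs × TotallyOrdered (S ∷ Fs) ×
          (∀ {P : Pred (Subset n) 0ℓ} → All P C → P S × All P Fs))
split S F (A ∷ C) (here refl ∷ ins) (r ∷ rs) =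
  inj₂ (C , inF C ins r , r ∷ rs , λ { (p ∷ ps) → p , ps })
  where
  inF : ∀ {l} (D : Vec _ l) → All (_∈ (S ∷ F)) D → All (Comparable S) D → All (_∈ F) D
  inF [] [] [] = []
  inF (B ∷ D) (here refl ∷ ins) (q ∷ _) = ⊥-elim (Comparable-irrefl q)
  inF (B ∷ D) (there B∈F ∷ ins) (_ ∷ qs) = B∈F ∷ inF D ins qs
split S F (A ∷ []) (there A∈F ∷ []) _ = inj₁ (A∈F ∷ [])
split S F (A ∷ C@(_ ∷ _)) (there A∈F ∷ ins) (r ∷ rs) with split S F C ins rs
... | inj₁ C⊆F = inj₁ (A∈F ∷ C⊆F)
... | inj₂ (Fs , Fs⊆F , q ∷ qs , f) =
  inj₂ (A ∷ Fs , A∈F ∷ Fs⊆F ,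
        (swap (proj₁ (f r)) ∷ q) ∷ proj₂ (f r) ∷ qs ,
        λ { (p ∷ ps) → proj₁ (f ps) , p ∷ proj₂ (f ps) })

totallyOrdered : {C : Vec (Subset n) m} → Linked _⊂_ C → TotallyOrdered C
totallyOrdered [] = []
totallyOrdered [-] = [] ∷ []
totallyOrdered (A⊂B ∷ l) = All.map inj₁ (Linked⇒All ⊂-trans A⊂B l) ∷ totallyOrdered l

chainFree-∷ : ∀ {S} {F : Vec (Subset n) m} →
              ChainFree k F → ¬ Completes k F S → ChainFree k (S ∷ F)
chainFree-∷ {S = S} {F} free ¬comp (C , C⊆ , linked)
  with split S F C C⊆ (totallyOrdered linked)
... | inj₁ C⊆F = free (C , C⊆F , linked)
... | inj₂ (Fs , Fs⊆F , ord , _) = ¬comp (Fs , Fs⊆F , ord)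

greedy : ∀ k (Ss : List (Subset n)) →
         ∃[ m ] Σ[ F ∈ Vec (Subset n) m ] Unique F × ChainFree k F ×
           (∀ {S} → S ListMem.∈ Ss → S ∉ F → Completes k F S)
greedy k [] = 0 , [] , [] , (λ { (_ ∷ _ , () ∷ _ , _) }) , λ ()
greedy k (S ∷ Ss) with greedy k Ss
... | m , F , uniq , free , sat with S ∈? F | completes? k F S
... | yes S∈F | _ = m , F , uniq , free ,
  λ { (ListAny.here refl) S∉F → ⊥-elim (S∉F S∈F) ; (ListAny.there i) → sat i }
... | no _ | yes comp = m , F , uniq , free ,
  λ { (ListAny.here refl) _ → comp ; (ListAny.there i) → sat i }
... | no S∉F | no ¬comp =
  suc m , S ∷ F , fresh F S∉F ∷ uniq , chainFree-∷ free ¬comp ,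
  λ { (ListAny.here refl) S∉ → ⊥-elim (S∉ (here refl))
    ; (ListAny.there i) T∉ → let Fs , Fs⊆F , ord = sat i (λ T∈F → T∉ (there T∈F))
                             in Fs , All.map there Fs⊆F , ord }
  where
  fresh : ∀ {l} (G : Vec _ l) → S ∉ G → All (λ T → ¬ S ≡ T) G
  fresh [] _ = []
  fresh (T ∷ G) S∉ = (λ eq → S∉ (here eq)) ∷ fresh G (λ S∈G → S∉ (there S∈G))

subsets : ∀ n → List (Subset n)
subsets zero = [] ∷ []
subsets (suc n) = mapˡ (inside ∷_) (subsets n) ++ mapˡ (outside ∷_) (subsets n)

∈-subsets : (S : Subset n) → S ListMem.∈ subsets n
∈-subsets [] = ListAny.here refl
∈-subsets (inside ∷ S) = ∈-++⁺ˡ (∈-map⁺ (inside ∷_) (∈-subsets S))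
∈-subsets {suc n} (outside ∷ S) =
  ∈-++⁺ʳ (mapˡ (inside ∷_) (subsets n)) (∈-map⁺ (outside ∷_) (∈-subsets S))

strongSize : ∀ n k → ∃ (StrongSize n k)
strongSize n k = let m , F , uniq , free , sat = greedy k (subsets n)
                 in m , F , uniq , free , λ S → sat (∈-subsets S)

weakSize : ∀ n k → ∃ (WeakSize n k)
weakSize n k = let m , F , uniq , _ , weak = strongSize n k in m , F , uniq , weak

-- Abstract only so that the brute-force search is never run by the type checker.
abstract
  strongMinimum : ∀ n k → ∃ (IsMinimum (StrongSize n k))
  strongMinimum n k = least (strongSize? n k) (strongSize n k)

  weakMinimum : ∀ n k → ∃ (IsMinimum (WeakSize n k))
  weakMinimum n k = least (weakSize? n k) (weakSize n k)

sat : ℕ → ℕ → ℕ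
sat n k = proj₁ (strongMinimum n k)

sat-isMinimum : ∀ n k → IsMinimum (StrongSize n k) (sat n k)
sat-isMinimum n k = proj₂ (strongMinimum n k)

wsat : ℕ → ℕ → ℕ
wsat n k = proj₁ (weakMinimum n k)

wsat-isMinimum : ∀ n k → IsMinimum (WeakSize n k) (wsat n k)
wsat-isMinimum n k = proj₂ (weakMinimum n k)

{-# OPTIONS --safe #-}

-- (i) A strongly saturating 6-Sperner family on [6] with 30 sets, containing ∅ and [6],
-- is found by computer.  If F is such a family on [k], then so is
-- {A, A ∪ {k + 1} : A ∈ F} on [k + 1]: passing to traces on [k] loses at most one set of
-- a chain, and a chain completing the trace of S lifts and gains ∅ or [k + 1].
--
-- (ii) Let G ⊆ 2^[k] contain an upper cover of every proper subset of [k], and let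
-- R = [n] \ [k].  Every S ⊆ [n] climbs through k - |S ∩ [k]| sets B ∪ R with B ∈ G and,
-- by complementation, descends through |S ∩ [k]| complements of such sets; hence
-- wsat(n,k) ≤ 2|G|.  To make G small, label the elements of [k] by residues mod m, each
-- residue being used at least t times, and let the weight of a set be the sum of its
-- labels.  Some residue class D of the weight has at most 2^k/m sets.  Adding an element
-- with the right label moves a set into D, except for the at most m 2^(k-t) sets that
-- contain a whole label class; for these an arbitrary upper cover is put into G.
-- With t = 2⌊log₂ k⌋ and m = ⌊k/t⌋ both parts are O(2^k log k / k).

module Submission where

open import Defs
open import Data.Bool using (if_then_else_)
open import Data.Bool.Properties using (not-involutive)
open import Data.Fin using (#_)
open import Data.Fin.Subset using (Subset; inside; outside; _⊂_; _⊆_; ⊤; ⊥; ∁; ∣_∣; ⁅_⁆; _∪_)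
open import Data.Fin.Subset.Properties
  using (p⊂q⇒∁p⊃∁q; ∣∁p∣≡n∸∣p∣; ∣p∣≤n; ∣⊤∣≡n; ⊂-trans; ⊆⊤; out⊂in; s⊂s; s⊆s; out⊆; drop-∷-⊆; drop-∷-⊂;
         _⊂?_; ⊆-min; ⊆-refl)
open import Data.List
  using (List; []; _∷_; length; deduplicate; upTo; filter; concatMap; cartesianProductWith)
  renaming (_++_ to _++ˡ_; map to mapˡ)
open import Data.List.Membership.Propositional using () renaming (_∈_ to _∈ˡ_; _∉_ to _∉ˡ_)
import Data.List.Membership.Propositional as ∈ˡ
open import Data.List.Membership.Propositional.Properties
  using (∈-deduplicate⁺; ∈-filter⁺; ∈-concatMap⁺; ∈-upTo⁺; ∈-upTo⁻; ∈-map⁺; ∈-map⁻; ∈-++⁺ˡ; ∈-++⁺ʳ)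
open import Data.List.Properties
  using (length-++; length-map; length-filter; length-deduplicate; length-upTo)
import Data.List.Relation.Unary.AllPairs as AllPairsˡ
open import Data.List.Relation.Unary.Any using () renaming (Any to Anyˡ; any? to anyˡ?)
import Data.List.Relation.Unary.Any as Anyˡ
open import Data.List.Relation.Unary.Unique.DecPropositional.Properties using (deduplicate-!)
open import Data.List.Relation.Unary.Unique.Propositional using () renaming (Unique to Uniqueˡ)
open import Data.Nat
  using (ℕ; zero; suc; _+_; _*_; _^_; _∸_; _≤_; _<_; _≤′_; ≤′-refl; ≤′-step; z≤n; s≤s;
         s<s; z<s; NonZero; _≟_; _<?_; ⌊_/2⌋; ⌈_/2⌉; >-nonZero)
open import Data.Nat.DivMod
open import Data.Nat.Induction using (<-rec)
open import Data.Nat.Logarithm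
  using (⌊log₂_⌋; ⌊log₂⌋-mono-≤; ⌊log₂[2^n]⌋≡n; ⌊log₂⌊n/2⌋⌋≡⌊log₂n⌋∸1)
open import Data.Nat.Properties hiding (_≟_; _<?_)
open import Data.Nat.Solver using (module +-*-Solver)
open import Data.Product using (∃-syntax; Σ-syntax; _×_; _,_; proj₁; proj₂)
open import Data.Sum using (_⊎_; inj₁; inj₂; [_,_]′) renaming (map to map⊎)
open import Data.Unit as Unit using (tt)
open import Data.Vec using (Vec; []; _∷_; _++_; map; fromList; splitAt; here)
open import Data.Vec.Membership.Propositional using (_∈_)
import Data.Vec.Membership.Propositional.Properties as ∈
open import Data.Vec.Properties using (map-∘; map-cong; map-id; map-++; ∷-injectiveʳ)
open import Data.Vec.Relation.Unary.All as All using (All; []; _∷_)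
import Data.Vec.Relation.Unary.All.Properties as All
open import Data.Vec.Relation.Unary.AllPairs as AllPairs using (AllPairs; []; _∷_)
import Data.Vec.Relation.Unary.AllPairs.Properties as AllPairs
import Data.Vec.Relation.Unary.Any as Any
import Data.Vec.Relation.Unary.Any.Properties as Any
open import Data.Vec.Relation.Unary.Linked using (Linked; _∷_)
open import Data.Vec.Relation.Unary.Unique.Propositional using (Unique)
import Data.Vec.Relation.Unary.Unique.Propositional.Properties as Unique
open import Function using (_∘_; id)
open import Level using (0ℓ)
open import Relation.Binary.PropositionalEquality
  using (_≡_; refl; sym; trans; cong; cong₂; subst; module ≡-Reasoning)
open import Relation.Nullary using (¬_; Dec; yes; no; ¬?; contradiction)
open import Relation.Nullary.Decidable using (_×-dec_; _⊎-dec_; _→-dec_; toWitness; does)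
open import Relation.Unary using (Pred; Decidable)

private
  variable
    j k l m n s : ℕ
    A B S : Subset n

-- Covers, complements and chains through a set

infix 4 _⋖_

_⋖_ : Subset n → Subset n → Set
A ⋖ B = A ⊂ B × ∣ B ∣ ≡ suc ∣ A ∣

∁-involutive : (A : Subset n) → ∁ (∁ A) ≡ A
∁-involutive A = begin
  ∁ (∁ A)  ≡⟨ map-∘ _ _ A ⟨
  map _ A  ≡⟨ map-cong not-involutive A ⟩
  map id A ≡⟨ map-id A ⟩
  A        ∎
  where open ≡-Reasoning

∁-⊂-swap : ∁ A ⊂ B → ∁ B ⊂ A
∁-⊂-swap {A = A} ∁A⊂B = subst (_ ⊂_) (∁-involutive A) (p⊂q⇒∁p⊃∁q ∁A⊂B)

∣∁p∣+∣p∣≡n : (A : Subset n) → ∣ ∁ A ∣ + ∣ A ∣ ≡ n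
∣∁p∣+∣p∣≡n A = trans (cong (_+ ∣ A ∣) (∣∁p∣≡n∸∣p∣ A)) (m∸n+n≡m (∣p∣≤n A))

ChainAbove : Pred (Subset n) 0ℓ → Subset n → ℕ → Set
ChainAbove {n} P A j = Σ[ C ∈ Vec (Subset n) j ] All P C × AllPairs _⊂_ (A ∷ C)

-- `P` describes the sets collected, `Q` is the invariant that permits the next step. A cover raises
-- the size by exactly one, so the climb from `A` has length `n - ∣ A ∣`.
climb : {P Q : Pred (Subset n) 0ℓ} →
        (∀ A → Q A → A ≡ ⊤ ⊎ ∃[ B ] A ⋖ B × P B × Q B) →
        ∀ j {A} → Q A → j + ∣ A ∣ ≡ n → ChainAbove P A j
climb step zero q _ = [] , [] , [] ∷ []
climb {n} step (suc j) {A} q eq with step A q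
-- At `⊤` the size is already `n`, which leaves no room for another step.
... | inj₁ refl =
  contradiction (sym (subst (λ c → suc j + c ≡ n) (∣⊤∣≡n n) eq)) (m≢1+n+m n)
... | inj₂ (B , (A⊂B , ∣B∣) , pB , qB)
  with C , pC , B⊂C ∷ ord ← climb step j {B} qB (trans (cong (j +_) ∣B∣) (trans (+-suc j _) eq))
  = B ∷ C , pB ∷ pC , (A⊂B ∷ All.map (⊂-trans A⊂B) B⊂C) ∷ B⊂C ∷ ord

-- Complementation turns a chain above `∁ S` into one below `S`. The two chains fit together because
-- each set of the first contains `S` and `S` contains each set of the second.
completes : {P Q : Pred (Subset n) 0ℓ} {F : Vec (Subset n) m} →
            (∀ {A} → P A → A ∈ F) → (∀ {A} → Q A → ∁ A ∈ F) →
            ChainAbove P S j → ChainAbove Q (∁ S) l → Completes (j + l) F S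
completes P⊆F Q⊆F (C , pC , S⊂C ∷ ordC) (D , qD , ∁S⊂D ∷ ordD) =
  C ++ map ∁ D ,
  All.++⁺ (All.map P⊆F pC) (All.map⁺ (All.map Q⊆F qD)) ,
  All.++⁺ (All.map inj₁ S⊂C) (All.map⁺ (All.map (inj₂ ∘ ∁-⊂-swap) ∁S⊂D)) ∷
  AllPairs.++⁺ (AllPairs.map inj₁ ordC)
    (AllPairs.map⁺ (AllPairs.map (inj₂ ∘ p⊂q⇒∁p⊃∁q) ordD))
    (All.map (λ S⊂U → All.map⁺
      (All.map (λ ∁S⊂V → inj₂ (⊂-trans (∁-⊂-swap ∁S⊂V) S⊂U)) ∁S⊂D)) S⊂C)

family : (L : List (Subset n)) → Vec (Subset n) (length (deduplicate _≟ˢ_ L))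
family L = fromList (deduplicate _≟ˢ_ L)

∈-family : (L : List (Subset n)) → A ∈ˡ L → A ∈ family L
∈-family L = ∈.∈-fromList⁺ ∘ ∈-deduplicate⁺ _≟ˢ_

family-unique : (L : List (Subset n)) → Unique (family L)
family-unique L = fromList⁺ (deduplicate-! _≟ˢ_ L)
  where
  fromList⁺ : {L : List (Subset n)} → Uniqueˡ L → Unique (fromList L)
  fromList⁺ AllPairsˡ.[] = []
  fromList⁺ (A∉L AllPairsˡ.∷ L!) = All.fromList⁺ A∉L ∷ fromList⁺ L!

-- Strong saturation in 2^[k]

-- A strictly monotone rank with values below k excludes chains of length k + 1.
record Doublable (k : ℕ) (F : Vec (Subset n) m) : Set where
  field
    unique     : Unique F
    saturating : WeaklySaturating k F
    ⊤∈F        : ⊤ ∈ F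
    ⊥∈F        : ⊥ ∈ F
    rank       : Subset n → ℕ
    rank<      : ∀ {A} → A ∈ F → rank A < k
    rank-mono  : ∀ {A B} → A ∈ F → B ∈ F → A ⊂ B → rank A < rank B

open Doublable

module _ {F : Vec (Subset n) m} (d : Doublable k F) where

  -- Each inclusion costs at least one unit of rank, and the rank of the last set is still below
  -- `k`.
  rank-chain : (C : Vec (Subset n) l) → All (_∈ F) (A ∷ C) → Linked _⊂_ (A ∷ C) →
               rank d A + l < k
  rank-chain {A = A} [] (A∈F ∷ _) _ =
    subst (_< k) (sym (+-identityʳ (rank d A))) (rank< d A∈F)
  rank-chain {l = suc l} {A = A} (B ∷ C) (A∈F ∷ B∈F ∷ C⊆F) (A⊂B ∷ linked) = begin-strict
    rank d A + suc l   ≡⟨ +-suc (rank d A) l ⟩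
    suc (rank d A) + l ≤⟨ +-monoˡ-≤ l (rank-mono d A∈F B∈F A⊂B) ⟩
    rank d B + l       <⟨ rank-chain C (B∈F ∷ C⊆F) linked ⟩
    k                  ∎
    where open ≤-Reasoning

  stronglySaturating : StronglySaturating k F
  stronglySaturating =
    (λ { (A ∷ C , C⊆F , linked) → <⇒≱ (rank-chain C C⊆F linked) (m≤n+m k (rank d A)) }) ,
    saturating d

⊆⇒≡⊎⊂ : {A B : Subset n} → A ⊆ B → A ≡ B ⊎ A ⊂ B
⊆⇒≡⊎⊂ {A = []}          {[]}          _   = inj₁ refl
⊆⇒≡⊎⊂ {A = outside ∷ A} {inside ∷ B}  A⊆B = inj₂ (out⊂in (drop-∷-⊆ A⊆B))
⊆⇒≡⊎⊂ {A = inside ∷ A}  {outside ∷ B} A⊆B with () ← A⊆B here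
⊆⇒≡⊎⊂ {A = outside ∷ A} {outside ∷ B} A⊆B = map⊎ (cong _) s⊂s (⊆⇒≡⊎⊂ (drop-∷-⊆ A⊆B))
⊆⇒≡⊎⊂ {A = inside ∷ A}  {inside ∷ B}  A⊆B = map⊎ (cong _) s⊂s (⊆⇒≡⊎⊂ (drop-∷-⊆ A⊆B))

double : Vec (Subset n) m → Vec (Subset (suc n)) (m + m)
double F = map (outside ∷_) F ++ map (inside ∷_) F

∈-double⁺ : ∀ x {F : Vec (Subset n) m} → A ∈ F → x ∷ A ∈ double F
∈-double⁺ outside     A∈F = ∈.∈-++⁺ˡ (∈.∈-map⁺ _ A∈F)
∈-double⁺ inside {F}  A∈F = ∈.∈-++⁺ʳ (map (outside ∷_) F) (∈.∈-map⁺ _ A∈F)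

∈-double⁻ : ∀ {x} {F : Vec (Subset n) m} → x ∷ A ∈ double F → A ∈ F
∈-double⁻ {F = F} i =
  [ Any.map ∷-injectiveʳ ∘ Any.map⁻ , Any.map ∷-injectiveʳ ∘ Any.map⁻ ]′
    (Any.++⁻ (map (outside ∷_) F) i)

∷-comparable : ∀ x → Comparable A B → Comparable (x ∷ A) (x ∷ B)
∷-comparable x = map⊎ s⊂s s⊂s

doublable-suc : {F : Vec (Subset n) m} → Doublable k F → Doublable (suc k) (double F)
doublable-suc {n} {k = k} {F = F} d = record
  { unique     = AllPairs.++⁺ (Unique.map⁺ ∷-injectiveʳ (unique d))
                   (Unique.map⁺ ∷-injectiveʳ (unique d))
                   (All.map⁺ (All.universal (λ _ → All.map⁺ (All.universal (λ _ ()) F)) F))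
  ; saturating = sat′
  ; ⊤∈F        = ∈-double⁺ inside (⊤∈F d)
  ; ⊥∈F        = ∈-double⁺ outside (⊥∈F d)
  ; rank       = rank′
  ; rank<      = rank′<
  ; rank-mono  = rank′-mono
  }
  where
  sat′ : WeaklySaturating (suc k) (double F)
  sat′ (outside ∷ A) A∉ with saturating d A (A∉ ∘ ∈-double⁺ outside)
  ... | C , C⊆F , A~C ∷ ord =
    -- The lifted chain avoids the new element, so the full set lies strictly above all of it, even
    -- if `⊤` occurs in `C`. The next clause is dual, with `⊥`.
    (inside ∷ ⊤) ∷ map (outside ∷_) C ,
    ∈-double⁺ inside (⊤∈F d) ∷ All.map⁺ (All.map (∈-double⁺ outside) C⊆F) ,
    (inj₁ (out⊂in ⊆⊤) ∷ All.map⁺ (All.map (∷-comparable outside) A~C)) ∷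
    All.map⁺ (All.universal (λ _ → inj₂ (out⊂in ⊆⊤)) C) ∷
    AllPairs.map⁺ (AllPairs.map (∷-comparable outside) ord)
  sat′ (inside ∷ A) A∉ with saturating d A (A∉ ∘ ∈-double⁺ inside)
  ... | C , C⊆F , A~C ∷ ord =
    (outside ∷ ⊥) ∷ map (inside ∷_) C ,
    ∈-double⁺ outside (⊥∈F d) ∷ All.map⁺ (All.map (∈-double⁺ inside) C⊆F) ,
    (inj₂ (out⊂in (⊆-min A)) ∷ All.map⁺ (All.map (∷-comparable inside) A~C)) ∷
    All.map⁺ (All.universal (λ B → inj₁ (out⊂in (⊆-min B))) C) ∷
    AllPairs.map⁺ (AllPairs.map (∷-comparable inside) ord)

  -- The extra unit for the new element keeps the rank strict on pairs with equal traces.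
  rank′ : Subset (suc n) → ℕ
  rank′ (outside ∷ A) = rank d A
  rank′ (inside ∷ A)  = suc (rank d A)

  rank′< : ∀ {A} → A ∈ double F → rank′ A < suc k
  rank′< {outside ∷ A} A∈ = m<n⇒m<1+n (rank< d (∈-double⁻ A∈))
  rank′< {inside ∷ A}  A∈ = s<s (rank< d (∈-double⁻ A∈))

  rank′-mono : ∀ {A B} → A ∈ double F → B ∈ double F → A ⊂ B → rank′ A < rank′ B
  rank′-mono {outside ∷ A} {outside ∷ B} A∈ B∈ A⊂B =
    rank-mono d (∈-double⁻ A∈) (∈-double⁻ B∈) (drop-∷-⊂ A⊂B)
  rank′-mono {inside ∷ A} {inside ∷ B} A∈ B∈ A⊂B =
    s<s (rank-mono d (∈-double⁻ A∈) (∈-double⁻ B∈) (drop-∷-⊂ A⊂B))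
  rank′-mono {inside ∷ A} {outside ∷ B} A∈ B∈ (A⊆B , _) with () ← A⊆B here
  rank′-mono {outside ∷ A} {inside ∷ B} A∈ B∈ (A⊆B , _) with ⊆⇒≡⊎⊂ (drop-∷-⊆ A⊆B)
  ... | inj₁ refl = ≤-refl
  ... | inj₂ A⊂B  = m<n⇒m<1+n (rank-mono d (∈-double⁻ A∈) (∈-double⁻ B∈) A⊂B)

-- The saturating family on six elements

wing : (Subset 4 → Subset 4) → List (Subset 6)
wing σ =
  -- Eight sets come from the product and seven from the list below. The map `σ` only relabels the
  -- first four elements, so both halves of the family have 15 sets.
  cartesianProductWith (λ A B → σ A ++ B) (⁅ # 0 ⁆ ∷ ⁅ # 2 ⁆ ∷ []) (subsets 2) ++ˡ
  mapˡ (λ A → σ A ++ ⊥)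
    (⊥ ∷ ⁅ # 1 ⁆ ∷ ⁅ # 3 ⁆ ∷ ⁅ # 1 ⁆ ∪ ⁅ # 3 ⁆ ∷ ∁ ⁅ # 0 ⁆ ∷ ∁ ⁅ # 2 ⁆ ∷ ⊤ ∷ [])

swapPairs : Subset 4 → Subset 4
swapPairs (a ∷ b ∷ c ∷ d ∷ []) = b ∷ a ∷ d ∷ c ∷ []

-- Inside lower every member is joined to ⊥, inside upper to ⊤,
-- every other set covers a member of lower and is covered by a member of upper, and
-- no member of upper covers a member of lower.
lower upper : List (Subset 6)
lower = wing id
upper = mapˡ ∁ (wing swapPairs)

_∈ˡ?_ : (A : Subset n) (L : List (Subset n)) → Dec (A ∈ˡ L)
A ∈ˡ? L = anyˡ? (A ≟ˢ_) L

_⋖?_ : (A B : Subset n) → Dec (A ⋖ B)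
A ⋖? B = (A ⊂? B) ×-dec (∣ B ∣ ≟ suc ∣ A ∣)

-- Iterated, this joins every set outside H to ⊤ by a saturated chain in G that avoids H.
Ascends : (G H : List (Subset n)) → Set
Ascends {n} G H =
  (A : Subset n) → A ∉ˡ H → A ≡ ⊤ ⊎ Anyˡ (λ B → A ⋖ B × B ∉ˡ H) G

ascends? : (G H : List (Subset n)) → Dec (Ascends G H)
ascends? G H = allSubset? λ A → ¬? (A ∈ˡ? H) →-dec
  ((A ≟ˢ ⊤) ⊎-dec anyˡ? (λ B → (A ⋖? B) ×-dec ¬? (B ∈ˡ? H)) G)

upper-ascends : Ascends upper lower
upper-ascends = toWitness {a? = ascends? upper lower} tt

∁lower-ascends : Ascends (mapˡ ∁ lower) (mapˡ ∁ upper)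
∁lower-ascends = toWitness {a? = ascends? (mapˡ ∁ lower) (mapˡ ∁ upper)} tt

ascend : {G H : List (Subset n)} → Ascends G H → A ∉ˡ H → j + ∣ A ∣ ≡ n →
         ChainAbove (_∈ˡ G) A j
ascend {j = j} {H = H} asc = climb step j
  where
  step : ∀ A → A ∉ˡ H → A ≡ ⊤ ⊎ ∃[ B ] A ⋖ B × B ∈ˡ _ × B ∉ˡ H
  step A A∉H with asc A A∉H
  ... | inj₁ eq  = inj₁ eq
  ... | inj₂ any = let B , B∈G , A⋖B , B∉H = ∈ˡ.find any in inj₂ (B , A⋖B , B∈G , B∉H)

∈-map-∁⁻ : {L : List (Subset n)} → A ∈ˡ mapˡ ∁ L → ∁ A ∈ˡ L
∈-map-∁⁻ A∈ with B , B∈L , refl ← ∈-map⁻ ∁ A∈ = subst (_∈ˡ _) (sym (∁-involutive B)) B∈L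

F₆ : Vec (Subset 6) 30
F₆ = family (upper ++ˡ lower)

upper⊆F₆ : A ∈ˡ upper → A ∈ F₆
upper⊆F₆ = ∈-family (upper ++ˡ lower) ∘ ∈-++⁺ˡ

lower⊆F₆ : A ∈ˡ lower → A ∈ F₆
lower⊆F₆ = ∈-family (upper ++ˡ lower) ∘ ∈-++⁺ʳ upper

-- A missing `S` is outside `lower`, hence climbs `∣ ∁ S ∣` steps through `upper`. It is also
-- outside `upper`, so `∁ S` climbs `∣ S ∣` steps through complements of members of `lower`.
-- Together these are 6 sets.
saturating₆ : WeaklySaturating 6 F₆
saturating₆ S S∉F = subst (λ k → Completes k F₆ S) (∣∁p∣+∣p∣≡n S)
  (completes upper⊆F₆ (lower⊆F₆ ∘ ∈-map-∁⁻)
    (ascend upper-ascends (S∉F ∘ lower⊆F₆) (∣∁p∣+∣p∣≡n S))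
    (ascend ∁lower-ascends
      (λ ∁S∈ → S∉F (upper⊆F₆ (subst (_∈ˡ upper) (∁-involutive S) (∈-map-∁⁻ ∁S∈))))
      (trans (+-comm ∣ S ∣ _) (∣∁p∣+∣p∣≡n S))))

-- Lowering `upper` by one level fits the sizes 0 to 6 into six ranks. Strictness survives the
-- passage from `lower` to `upper`, where the size jumps by at least two.
rank₆ : Subset 6 → ℕ
rank₆ A = if does (A ∈ˡ? lower) then ∣ A ∣ else ∣ A ∣ ∸ 1

doublable₆ : Doublable 6 F₆
doublable₆ = record
  { unique     = family-unique (upper ++ˡ lower)
  ; saturating = saturating₆
  ; ⊤∈F        = toWitness {a? = ⊤ ∈? F₆} tt
  ; ⊥∈F        = toWitness {a? = ⊥ ∈? F₆} tt
  ; rank       = rank₆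
  ; rank<      = All.lookup (toWitness {a? = All.all? (λ A → rank₆ A <? 6) F₆} tt)
  ; rank-mono  = λ A∈F B∈F → All.lookup (All.lookup (toWitness
      {a? = All.all? (λ A → All.all? (λ B → (A ⊂? B) →-dec (rank₆ A <? rank₆ B)) F₆) F₆}
      tt) A∈F) B∈F
  }

doublable : 6 ≤′ k → ∃[ m ] (Σ[ F ∈ Vec (Subset k) m ] Doublable k F) × 32 * m ≡ 15 * 2 ^ k
-- Here `32 * 30 = 15 * 2 ^ 6`; each doubling multiplies both sides by two.
doublable ≤′-refl = 30 , (F₆ , doublable₆) , refl
doublable {suc k} (≤′-step 6≤k) with m , (F , d) , eq ← doublable 6≤k =
  m + m , (double F , doublable-suc d) , (begin
    32 * (m + m)         ≡⟨ *-distribˡ-+ 32 m m ⟩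
    32 * m + 32 * m      ≡⟨ cong (λ x → x + x) eq ⟩
    15 * 2 ^ k + 15 * 2 ^ k ≡⟨ *-distribˡ-+ 15 (2 ^ k) (2 ^ k) ⟨
    15 * (2 ^ k + 2 ^ k) ≡⟨ cong (λ x → 15 * (2 ^ k + x)) (+-identityʳ (2 ^ k)) ⟨
    15 * 2 ^ suc k       ∎)
  where open ≡-Reasoning

sat-diagonal-≤ : 6 ≤ k → 16 * sat k k ≤ 15 * 2 ^ (k ∸ 1)
sat-diagonal-≤ {k@(suc k′)} 6≤k with m , (F , d) , eq ← doublable (≤⇒≤′ 6≤k) =
  ≤-trans (*-monoʳ-≤ 16 (proj₂ (sat-isMinimum k k) m (F , unique d , stronglySaturating d)))
    (≤-reflexive (*-cancelˡ-≡ (16 * m) (15 * 2 ^ k′) 2 (begin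
      2 * (16 * m)        ≡⟨ *-assoc 2 16 m ⟨
      32 * m              ≡⟨ eq ⟩
      15 * (2 * 2 ^ k′)   ≡⟨ *-assoc 15 2 (2 ^ k′) ⟨
      2 * 15 * 2 ^ k′     ≡⟨ *-assoc 2 15 (2 ^ k′) ⟩
      2 * (15 * 2 ^ k′)   ∎)))
  where open ≡-Reasoning

-- Weak saturation in 2^[n]

length-subsets : ∀ n → length (subsets n) ≡ 2 ^ n
length-subsets zero    = refl
length-subsets (suc n) = begin
  length (subsets (suc n))
    ≡⟨ length-++ (mapˡ (inside ∷_) (subsets n)) ⟩
  length (mapˡ (inside ∷_) (subsets n)) + length (mapˡ (outside ∷_) (subsets n))
    ≡⟨ cong₂ _+_ (length-map _ (subsets n)) (length-map _ (subsets n)) ⟩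
  length (subsets n) + length (subsets n)
    ≡⟨ cong (λ x → x + x) (length-subsets n) ⟩
  2 ^ n + 2 ^ n
    ≡⟨ cong (2 ^ n +_) (+-identityʳ (2 ^ n)) ⟨
  2 ^ suc n ∎
  where open ≡-Reasoning

-- Upper covers, weights and label classes

∷-⋖ : ∀ x → A ⋖ B → x ∷ A ⋖ x ∷ B
∷-⋖ outside (A⊂B , eq) = s⊂s A⊂B , eq
∷-⋖ inside  (A⊂B , eq) = s⊂s A⊂B , cong suc eq

out⋖in : (A : Subset n) → outside ∷ A ⋖ inside ∷ A
out⋖in A = out⊂in ⊆-refl , refl

-- The arbitrary upper cover for the exceptional sets: the first missing element is added. The value
-- at `⊤` is a default.
raise : Subset n → Subset n
raise []            = []
raise (outside ∷ A) = inside ∷ A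
raise (inside ∷ A)  = inside ∷ raise A

raise-⋖ : (A : Subset n) → A ≡ ⊤ ⊎ A ⋖ raise A
raise-⋖ []            = inj₁ refl
raise-⋖ (outside ∷ A) = inj₂ (out⋖in A)
raise-⋖ (inside ∷ A)  = map⊎ (cong (inside ∷_)) (∷-⋖ inside) (raise-⋖ A)

weight : Vec ℕ n → Subset n → ℕ
weight []      []            = 0
weight (x ∷ ℓ) (outside ∷ A) = weight ℓ A
weight (x ∷ ℓ) (inside ∷ A)  = x + weight ℓ A

containingClass : Vec ℕ n → ℕ → List (Subset n)
containingClass []      b = [] ∷ []
containingClass (x ∷ ℓ) b with x ≟ b
... | yes _ = mapˡ (inside ∷_) (containingClass ℓ b)
... | no _  = mapˡ (inside ∷_) (containingClass ℓ b) ++ˡ mapˡ (outside ∷_) (containingClass ℓ b)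

classSize : Vec ℕ n → ℕ → ℕ
classSize []      b = 0
classSize (x ∷ ℓ) b with x ≟ b
... | yes _ = suc (classSize ℓ b)
... | no _  = classSize ℓ b

-- The vector is searched for an element labelled `b` outside `A`. If there is none, `A` contains
-- the whole class.
add-label : (ℓ : Vec ℕ n) (b : ℕ) (A : Subset n) →
            A ∈ˡ containingClass ℓ b ⊎ ∃[ B ] A ⋖ B × weight ℓ B ≡ b + weight ℓ A
add-label []      b []            = inj₁ (Anyˡ.here refl)
add-label (x ∷ ℓ) b (inside ∷ A) with add-label ℓ b A | x ≟ b
... | inj₁ A∈ | yes _ = inj₁ (∈-map⁺ (inside ∷_) A∈)
... | inj₁ A∈ | no _  = inj₁ (∈-++⁺ˡ (∈-map⁺ (inside ∷_) A∈))
... | inj₂ (B , A⋖B , eq) | _ = inj₂ (inside ∷ B , ∷-⋖ inside A⋖B , (begin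
  x + weight ℓ B       ≡⟨ cong (x +_) eq ⟩
  x + (b + weight ℓ A) ≡⟨ +-assoc x b _ ⟨
  x + b + weight ℓ A   ≡⟨ cong (_+ weight ℓ A) (+-comm x b) ⟩
  b + x + weight ℓ A   ≡⟨ +-assoc b x _ ⟩
  b + (x + weight ℓ A) ∎))
  where open ≡-Reasoning
add-label (x ∷ ℓ) b (outside ∷ A) with x ≟ b
... | yes refl = inj₂ (inside ∷ A , out⋖in A , refl)
... | no _ with add-label ℓ b A
...   | inj₁ A∈ = inj₁ (∈-++⁺ʳ (mapˡ (inside ∷_) (containingClass ℓ b)) (∈-map⁺ (outside ∷_) A∈))
...   | inj₂ (B , A⋖B , eq) = inj₂ (outside ∷ B , ∷-⋖ outside A⋖B , eq)

-- Each element labelled `b` fixes one coordinate and so halves the number of sets.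
length-containingClass : (ℓ : Vec ℕ n) (b : ℕ) →
                         length (containingClass ℓ b) * 2 ^ classSize ℓ b ≡ 2 ^ n
length-containingClass []      b = refl
length-containingClass {suc n} (x ∷ ℓ) b with x ≟ b
... | yes _ = begin
  length (mapˡ (inside ∷_) (containingClass ℓ b)) * (2 * p)
    ≡⟨ cong (_* (2 * p)) (length-map (inside ∷_) (containingClass ℓ b)) ⟩
  c * (2 * p)
    ≡⟨ solve 2 (λ c p → c :* (con 2 :* p) := con 2 :* (c :* p)) refl c p ⟩
  2 * (c * p)
    ≡⟨ cong (2 *_) (length-containingClass ℓ b) ⟩
  2 ^ suc n ∎
  where
  open ≡-Reasoning
  open +-*-Solver
  c = length (containingClass ℓ b)
  p = 2 ^ classSize ℓ b
... | no _ = begin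
  length (mapˡ (inside ∷_) (containingClass ℓ b) ++ˡ mapˡ (outside ∷_) (containingClass ℓ b)) * p
    ≡⟨ cong (_* p) (length-++ (mapˡ (inside ∷_) (containingClass ℓ b))) ⟩
  (length (mapˡ (inside ∷_) (containingClass ℓ b)) + length (mapˡ (outside ∷_) (containingClass ℓ b))) * p
    ≡⟨ cong (_* p) (cong₂ _+_ (length-map _ (containingClass ℓ b)) (length-map _ (containingClass ℓ b))) ⟩
  (c + c) * p
    ≡⟨ solve 2 (λ c p → (c :+ c) :* p := con 2 :* (c :* p)) refl c p ⟩
  2 * (c * p)
    ≡⟨ cong (2 *_) (length-containingClass ℓ b) ⟩
  2 ^ suc n ∎
  where
  open ≡-Reasoning
  open +-*-Solver
  c = length (containingClass ℓ b)
  p = 2 ^ classSize ℓ b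

-- Counting and averaging over fibres

module _ {a} {X : Set a} where

  length-concatMap-≤ : (f : ℕ → List X) (q N : ℕ) → (∀ b → b < m → length (f b) * q ≤ N) →
                       length (concatMap f (upTo m)) * q ≤ m * N
  length-concatMap-≤ {m} f q N bound = go (upTo m) (λ b∈ → bound _ (∈-upTo⁻ b∈)) (length-upTo m)
    where
    open ≤-Reasoning
    go : ∀ {m} (bs : List ℕ) → (∀ {b} → b ∈ˡ bs → length (f b) * q ≤ N) → length bs ≡ m →
         length (concatMap f bs) * q ≤ m * N
    go []       _     refl = z≤n
    go (b ∷ bs) bound refl = begin
      length (f b ++ˡ concatMap f bs) * q
        ≡⟨ cong (_* q) (length-++ (f b)) ⟩
      (length (f b) + length (concatMap f bs)) * q
        ≡⟨ *-distribʳ-+ q (length (f b)) _ ⟩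
      length (f b) * q + length (concatMap f bs) * q
        ≤⟨ +-mono-≤ (bound (Anyˡ.here refl)) (go bs (bound ∘ Anyˡ.there) refl) ⟩
      N + length bs * N ∎

  length-filter-disjoint :
    {P Q R : Pred X 0ℓ} (P? : Decidable P) (Q? : Decidable Q) (R? : Decidable R) →
    (∀ {x} → P x → R x) → (∀ {x} → Q x → R x) → (∀ {x} → P x → ¬ Q x) →
    ∀ xs → length (filter P? xs) + length (filter Q? xs) ≤ length (filter R? xs)
  length-filter-disjoint P? Q? R? P⇒R Q⇒R P⇒¬Q [] = z≤n
  length-filter-disjoint P? Q? R? P⇒R Q⇒R P⇒¬Q (x ∷ xs)
    with P? x | Q? x | R? x | length-filter-disjoint P? Q? R? P⇒R Q⇒R P⇒¬Q xs
  ... | no _  | no _  | no _  | ih = ih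
  ... | no _  | no _  | yes _ | ih = m≤n⇒m≤1+n ih
  ... | yes _ | no _  | yes _ | ih = s≤s ih
  ... | no _  | yes _ | yes _ | ih = ≤-trans (≤-reflexive (+-suc _ _)) (s≤s ih)
  ... | yes p | yes q | _     | _  = contradiction q (P⇒¬Q p)
  ... | yes p | _     | no ¬r | _  = contradiction (P⇒R p) ¬r
  ... | _     | yes q | no ¬r | _  = contradiction (Q⇒R q) ¬r

  module _ (g : X → ℕ) where

    fibre below : ℕ → List X → ℕ
    fibre c xs = length (filter (λ x → g x ≟ c) xs)
    below c xs = length (filter (λ x → g x <? c) xs)

    below-suc : ∀ c xs → below c xs + fibre c xs ≤ below (suc c) xs
    below-suc c = length-filter-disjoint (λ x → g x <? c) (λ x → g x ≟ c) (λ x → g x <? suc c)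
      m<n⇒m<1+n (λ { refl → n<1+n c }) <⇒≢

    -- Pigeonhole by induction: the smaller of the old choice and the new fibre is kept. Counting
    -- with `below` lets the new, disjoint fibre pay for the increased factor.
    small-fibre-below : ∀ m xs → ∃[ c ] c < suc m × suc m * fibre c xs ≤ below (suc m) xs
    small-fibre-below zero xs = 0 , z<s , (begin
      fibre 0 xs + 0          ≡⟨ +-identityʳ _ ⟩
      fibre 0 xs              ≤⟨ m≤n+m _ (below 0 xs) ⟩
      below 0 xs + fibre 0 xs ≤⟨ below-suc 0 xs ⟩
      below 1 xs              ∎)
      where open ≤-Reasoning
    small-fibre-below (suc m) xs with small-fibre-below m xs
    ... | c , c≤m , ih with ≤-total (fibre c xs) (fibre (suc m) xs)
    ...   | inj₁ le = c , m<n⇒m<1+n c≤m , (begin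
      fibre c xs + suc m * fibre c xs          ≤⟨ +-mono-≤ le ih ⟩
      fibre (suc m) xs + below (suc m) xs      ≡⟨ +-comm (fibre (suc m) xs) _ ⟩
      below (suc m) xs + fibre (suc m) xs      ≤⟨ below-suc (suc m) xs ⟩
      below (suc (suc m)) xs                   ∎)
      where open ≤-Reasoning
    ...   | inj₂ ge = suc m , n<1+n (suc m) , (begin
      fibre (suc m) xs + suc m * fibre (suc m) xs ≤⟨ +-monoʳ-≤ _ (≤-trans (*-monoʳ-≤ (suc m) ge) ih) ⟩
      fibre (suc m) xs + below (suc m) xs         ≡⟨ +-comm (fibre (suc m) xs) _ ⟩
      below (suc m) xs + fibre (suc m) xs         ≤⟨ below-suc (suc m) xs ⟩
      below (suc (suc m)) xs                      ∎)
      where open ≤-Reasoning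

    small-fibre : ∀ m .{{_ : NonZero m}} xs → ∃[ c ] c < m × m * fibre c xs ≤ length xs
    small-fibre (suc m) xs =
      let c , c<m , le = small-fibre-below m xs in c , c<m , ≤-trans le (length-filter _ xs)

-- Position i, counted from the end of the vector, is labelled i % m.
labels : (m k : ℕ) .{{_ : NonZero m}} → Vec ℕ k
labels m zero    = []
labels m (suc k) = k % m ∷ labels m k

module _ (m : ℕ) .{{_ : NonZero m}} where

  classSize-mono : ∀ b → j ≤′ k → classSize (labels m j) b ≤ classSize (labels m k) b
  classSize-mono b ≤′-refl       = ≤-refl
  classSize-mono b (≤′-step {k} j≤k) with k % m ≟ b
  ... | yes _ = m≤n⇒m≤1+n (classSize-mono b j≤k)
  ... | no _  = classSize-mono b j≤k

  classSize-hit : ∀ {b} → b < m → ∀ a →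
                  suc (classSize (labels m (b + a * m)) b) ≡
                  classSize (labels m (suc (b + a * m))) b
  classSize-hit {b} b<m a with (b + a * m) % m ≟ b
  ... | yes _ = refl
  ... | no ≢b = contradiction (trans ([m+kn]%n≡m%n b a m) (m<n⇒m%n≡m b<m)) ≢b

  -- The label `b` occurs at positions `b`, `b + m`, ..., `b + (t - 1) * m`, all below `t * m` since
  -- `b < m`.
  ≤-classSize : ∀ {b} → b < m → ∀ t → t * m ≤ k → t ≤ classSize (labels m k) b
  ≤-classSize b<m zero _ = z≤n
  ≤-classSize {k} {b} b<m (suc t) le = begin
    suc t                                       ≤⟨ s≤s (≤-classSize b<m t (m≤n+m (t * m) b)) ⟩
    suc (classSize (labels m (b + t * m)) b)    ≡⟨ classSize-hit b<m t ⟩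
    classSize (labels m (suc (b + t * m))) b    ≤⟨ classSize-mono b (≤⇒≤′ fits) ⟩
    classSize (labels m k) b                    ∎
    where
    open ≤-Reasoning
    fits : suc (b + t * m) ≤ k
    fits = ≤-trans (+-monoˡ-≤ (t * m) b<m) le

  residue-shift : ∀ {c} w → c < m → ∃[ b ] b < m × (b + w) % m ≡ c
  residue-shift {c} w c<m = d % m , m%n<n d m , (begin
    (d % m + w) % m               ≡⟨ %-distribˡ-+ (d % m) w m ⟩
    (d % m % m + w % m) % m       ≡⟨ cong (λ x → (x + w % m) % m) (m%n%n≡m%n d m) ⟩
    (d % m + w % m) % m           ≡⟨ cong (λ x → (d % m + x) % m) (m%n%n≡m%n w m) ⟨
    (d % m + w % m % m) % m       ≡⟨ %-distribˡ-+ d (w % m) m ⟨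
    (d + w % m) % m               ≡⟨ cong (_% m) (+-assoc c (m ∸ w % m) (w % m)) ⟩
    (c + (m ∸ w % m + w % m)) % m ≡⟨ cong (λ x → (c + x) % m) (m∸n+n≡m (m%n≤n w m)) ⟩
    (c + m) % m                   ≡⟨ [m+n]%n≡m%n c m ⟩
    c % m                         ≡⟨ m<n⇒m%n≡m c<m ⟩
    c                             ∎)
    where
    open ≡-Reasoning
    -- A representative of `c - w` modulo `m`; the truncated subtraction is exact because
    -- `w % m ≤ m`.
    d = c + (m ∸ w % m)

Dominating : List (Subset k) → Set
Dominating G = ∀ A → A ≡ ⊤ ⊎ ∃[ B ] A ⋖ B × B ∈ˡ G

-- D is a residue class of the weight: a set A has an upper cover in D unless it
-- contains the whole label class that leads from its weight to this residue.
dominating : ∀ t m .{{_ : NonZero m}} k → t * m ≤ k →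
             ∃[ D ] ∃[ E ] Dominating {k} (D ++ˡ E) ×
               m * length D ≤ 2 ^ k × length E * 2 ^ t ≤ m * 2 ^ k
dominating t m k tm≤k = D , mapˡ raise full , dominates , D-small , E-small
  where
  open ≤-Reasoning
  ℓ = labels m k
  residue : Subset k → ℕ
  residue A = weight ℓ A % m
  smallest : ∃[ c ] c < m × m * fibre residue c (subsets k) ≤ length (subsets k)
  smallest = small-fibre residue m (subsets k)
  c = proj₁ smallest
  c<m : c < m
  c<m = proj₁ (proj₂ smallest)
  D = filter (λ A → residue A ≟ c) (subsets k)
  full = concatMap (containingClass ℓ) (upTo m)

  D-small : m * length D ≤ 2 ^ k
  D-small = ≤-trans (proj₂ (proj₂ smallest)) (≤-reflexive (length-subsets k))

  E-small : length (mapˡ raise full) * 2 ^ t ≤ m * 2 ^ k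
  E-small = begin
    length (mapˡ raise full) * 2 ^ t ≡⟨ cong (_* 2 ^ t) (length-map raise full) ⟩
    length full * 2 ^ t ≤⟨ length-concatMap-≤ (containingClass ℓ) (2 ^ t) (2 ^ k) bound ⟩
    m * 2 ^ k ∎
    where
    bound : ∀ b → b < m → length (containingClass ℓ b) * 2 ^ t ≤ 2 ^ k
    bound b b<m = begin
      length (containingClass ℓ b) * 2 ^ t
        ≤⟨ *-monoʳ-≤ (length (containingClass ℓ b)) (^-monoʳ-≤ 2 (≤-classSize m b<m t tm≤k)) ⟩
      length (containingClass ℓ b) * 2 ^ classSize ℓ b
        ≡⟨ length-containingClass ℓ b ⟩
      2 ^ k ∎

  dominates : Dominating (D ++ˡ mapˡ raise full)
  -- The label `b` is the one that moves the weight of `A` into the residue `c`.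
  dominates A with residue-shift m (weight ℓ A) c<m
  ... | b , b<m , b+w≡c with add-label ℓ b A
  ...   | inj₂ (B , A⋖B , eq) = inj₂ (B , A⋖B , ∈-++⁺ˡ
            (∈-filter⁺ _ (∈-subsets B) (trans (cong (_% m) eq) b+w≡c)))
  ...   | inj₁ A∈ with raise-⋖ A
  ...     | inj₁ A≡⊤ = inj₁ A≡⊤
  ...     | inj₂ A⋖  = inj₂ (raise A , A⋖ , ∈-++⁺ʳ D (∈-map⁺ raise
              (∈-concatMap⁺ (containingClass ℓ) (∈ˡ.lose (∈-upTo⁺ b<m) A∈))))

-- From dominating families to weak saturation

++-⊆ : {A B : Subset k} {S T : Subset s} → A ⊆ B → S ⊆ T → A ++ S ⊆ B ++ T
++-⊆ {A = []}          {[]}          A⊆B S⊆T = S⊆T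
++-⊆ {A = outside ∷ A} {y ∷ B}       A⊆B S⊆T = out⊆ (++-⊆ (drop-∷-⊆ A⊆B) S⊆T)
++-⊆ {A = inside ∷ A}  {inside ∷ B}  A⊆B S⊆T = s⊆s (++-⊆ (drop-∷-⊆ A⊆B) S⊆T)
++-⊆ {A = inside ∷ A}  {outside ∷ B} A⊆B S⊆T with () ← A⊆B here

++-⊂ : {A B : Subset k} {S T : Subset s} → A ⊂ B → S ⊆ T → A ++ S ⊂ B ++ T
++-⊂ {A = []}          {[]}          (_ , () , _)
++-⊂ {A = outside ∷ A} {outside ∷ B} A⊂B S⊆T = s⊂s (++-⊂ (drop-∷-⊂ A⊂B) S⊆T)
++-⊂ {A = outside ∷ A} {inside ∷ B}  A⊂B S⊆T = out⊂in (++-⊆ (drop-∷-⊆ (proj₁ A⊂B)) S⊆T)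
++-⊂ {A = inside ∷ A}  {inside ∷ B}  A⊂B S⊆T = s⊂s (++-⊂ (drop-∷-⊂ A⊂B) S⊆T)
++-⊂ {A = inside ∷ A}  {outside ∷ B} A⊂B S⊆T with () ← proj₁ A⊂B here

-- A set S on [k + s] climbs to ⊤ through at least as many sets B ∪ {k + 1, …, k + s}
-- as its trace on [k] does, whatever S does on the last s elements.
wsat-≤ : {G : List (Subset k)} → Dominating G → ∀ s → wsat (k + s) k ≤ length G + length G
wsat-≤ {k} {G} dom s = ≤-trans
  (proj₂ (wsat-isMinimum (k + s) k) _ (family L , family-unique L , λ S _ → saturated S))
  (≤-trans (length-deduplicate _≟ˢ_ L) (≤-reflexive (begin
    length L                             ≡⟨ length-++ G⁺ ⟩
    length G⁺ + length (mapˡ ∁ G⁺)       ≡⟨ cong (length G⁺ +_) (length-map ∁ G⁺) ⟩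
    length G⁺ + length G⁺                ≡⟨ cong (λ x → x + x) (length-map _ G) ⟩
    length G + length G                  ∎)))
  where
  open ≡-Reasoning
  G⁺ = mapˡ (_++ ⊤ {s}) G
  L = G⁺ ++ˡ mapˡ ∁ G⁺

  above : (A : Subset k) (T : Subset s) → j + ∣ A ∣ ≡ k → ChainAbove (_∈ˡ G⁺) (A ++ T) j
  above {j} A T eq
    with C , C⊆G , A⊂C ∷ ord ← climb {P = _∈ˡ G} {Q = λ _ → Unit.⊤}
           (λ A _ → map⊎ id (λ (B , A⋖B , B∈G) → B , A⋖B , B∈G , tt) (dom A)) j {A} tt eq
    = map (_++ ⊤) C , All.map⁺ (All.map (∈-map⁺ _) C⊆G) ,
      All.map⁺ (All.map (λ A⊂B → ++-⊂ A⊂B ⊆⊤) A⊂C) ∷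
      AllPairs.map⁺ (AllPairs.map (λ B⊂C → ++-⊂ B⊂C ⊆⊤) ord)

  saturated : (S : Subset (k + s)) → Completes k (family L) S
  saturated S with A , T , refl ← splitAt k S =
    -- The trace `A` gives `∣ ∁ A ∣` sets above `S` and `∣ A ∣` below it, together `k`.
    subst (λ k′ → Completes k′ (family L) (A ++ T)) (∣∁p∣+∣p∣≡n A)
      (completes (∈-family L ∘ ∈-++⁺ˡ) (∈-family L ∘ ∈-++⁺ʳ G⁺ ∘ ∈-map⁺ ∁)
        (above A T (∣∁p∣+∣p∣≡n A))
        (subst (λ S → ChainAbove (_∈ˡ G⁺) S ∣ A ∣) (sym (map-++ _ A T))
          (above (∁ A) (∁ T) (trans (+-comm ∣ A ∣ _) (∣∁p∣+∣p∣≡n A)))))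

-- Logarithm estimates and the choice of parameters

k<2^[1+⌊log₂k⌋] : ∀ k → k < 2 ^ suc ⌊log₂ k ⌋
k<2^[1+⌊log₂k⌋] k = ≰⇒> λ le → n≮n ⌊log₂ k ⌋
  (subst (_≤ ⌊log₂ k ⌋) (⌊log₂[2^n]⌋≡n (suc ⌊log₂ k ⌋)) (⌊log₂⌋-mono-≤ le))

-- Strong induction by halving, which lowers the logarithm by exactly one when `k` is at least 2.
2^⌊log₂k⌋≤k : ∀ k → 1 ≤ k → 2 ^ ⌊log₂ k ⌋ ≤ k
2^⌊log₂k⌋≤k = <-rec _ step
  where
  open ≤-Reasoning
  step : ∀ k → (∀ {j} → j < k → 1 ≤ j → 2 ^ ⌊log₂ j ⌋ ≤ j) → 1 ≤ k → 2 ^ ⌊log₂ k ⌋ ≤ k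
  step (suc zero)        rec _ = ≤-refl
  step k@(suc (suc k′)) rec _ = begin
    2 ^ ⌊log₂ k ⌋               ≡⟨ cong (2 ^_) (m∸n+n≡m 1≤log) ⟨
    2 ^ (⌊log₂ k ⌋ ∸ 1 + 1)     ≡⟨ cong (λ x → 2 ^ (x + 1)) (⌊log₂⌊n/2⌋⌋≡⌊log₂n⌋∸1 k) ⟨
    2 ^ (⌊log₂ ⌊ k /2⌋ ⌋ + 1)   ≡⟨ cong (2 ^_) (+-comm ⌊log₂ ⌊ k /2⌋ ⌋ 1) ⟩
    2 * 2 ^ ⌊log₂ ⌊ k /2⌋ ⌋     ≤⟨ *-monoʳ-≤ 2 (rec (⌊n/2⌋<n (suc k′)) (s≤s z≤n)) ⟩
    2 * ⌊ k /2⌋                 ≡⟨ cong (⌊ k /2⌋ +_) (+-identityʳ _) ⟩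
    ⌊ k /2⌋ + ⌊ k /2⌋           ≤⟨ +-monoʳ-≤ ⌊ k /2⌋ (⌊n/2⌋≤⌈n/2⌉ k) ⟩
    ⌊ k /2⌋ + ⌈ k /2⌉           ≡⟨ ⌊n/2⌋+⌈n/2⌉≡n k ⟩
    k                           ∎
    where
    1≤log : 1 ≤ ⌊log₂ k ⌋
    1≤log = ⌊log₂⌋-mono-≤ {2} {k} (s≤s (s≤s z≤n))

2*n≤2^n : ∀ n → 1 ≤ n → 2 * n ≤ 2 ^ n
2*n≤2^n (suc zero)        _ = ≤-refl
2*n≤2^n (suc n@(suc n′)) _ = begin
  2 * suc n         ≡⟨ *-suc 2 n ⟩
  2 + 2 * n         ≤⟨ +-monoˡ-≤ (2 * n) (*-monoʳ-≤ 2 (s≤s z≤n)) ⟩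
  2 * n + 2 * n     ≤⟨ +-mono-≤ (2*n≤2^n n (s≤s z≤n)) (2*n≤2^n n (s≤s z≤n)) ⟩
  2 ^ n + 2 ^ n     ≡⟨ cong (2 ^ n +_) (+-identityʳ _) ⟨
  2 ^ suc n         ∎
  where open ≤-Reasoning

-- The class `D` is small because `q` is at least `k / (4 * L)`, and `E` because `2 ^ t` is at least
-- `k * k / 4`. Each contributes a factor 4, and using both a family and its complements doubles the
-- sum to 16.
wsat-bound : ∀ k s → 6 ≤ k → k * wsat (k + s) k ≤ 16 * (⌊log₂ k ⌋ * 2 ^ k)
wsat-bound k s 6≤k = bound (dominating t q k tm≤k)
  where
  open ≤-Reasoning
  open +-*-Solver
  L = ⌊log₂ k ⌋
  t = 2 * L
  1≤L : 1 ≤ L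
  1≤L = ⌊log₂⌋-mono-≤ {2} (≤-trans (s≤s (s≤s z≤n)) 6≤k)
  1≤k : 1 ≤ k
  1≤k = ≤-trans (s≤s z≤n) 6≤k
  instance
    t≢0 : NonZero t
    t≢0 = >-nonZero (≤-trans 1≤L (m≤n*m L 2))
    k≢0 : NonZero k
    k≢0 = >-nonZero 1≤k
  q = k / t
  1≤q : 1 ≤ q
  -- The chain `t = 2 * L ≤ 2 ^ L ≤ k` leaves room for at least one label.
  1≤q = m≥n⇒m/n>0 (≤-trans (2*n≤2^n L 1≤L) (2^⌊log₂k⌋≤k k 1≤k))
  instance
    q≢0 : NonZero q
    q≢0 = >-nonZero 1≤q
  tm≤k : t * q ≤ k
  tm≤k = ≤-trans (≤-reflexive (*-comm t q)) (m/n*n≤m k t)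

  k≤4qL : k ≤ 4 * (q * L)
  k≤4qL = begin
    k                 ≡⟨ m≡m%n+[m/n]*n k t ⟩
    k % t + q * t     ≤⟨ +-monoˡ-≤ (q * t) (m%n≤n k t) ⟩
    -- Since `q` is positive, the remainder is absorbed by a second `q * t`.
    t + q * t         ≤⟨ +-monoˡ-≤ (q * t) (m≤n*m t q) ⟩
    q * t + q * t     ≡⟨ solve 2 (λ q l → q :* (con 2 :* l) :+ q :* (con 2 :* l) := con 4 :* (q :* l)) refl q L ⟩
    4 * (q * L)      ∎

  k²≤4*2^t : k * k ≤ 4 * 2 ^ t
  k²≤4*2^t = begin
    k * k                       ≤⟨ *-mono-≤ (<⇒≤ (k<2^[1+⌊log₂k⌋] k)) (<⇒≤ (k<2^[1+⌊log₂k⌋] k)) ⟩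
    2 * 2 ^ L * (2 * 2 ^ L)   ≡⟨ solve 1 (λ p → con 2 :* p :* (con 2 :* p) := con 4 :* (p :* p)) refl (2 ^ L) ⟩
    4 * (2 ^ L * 2 ^ L)       ≡⟨ cong (4 *_) (^-distribˡ-+-* 2 L L) ⟨
    4 * 2 ^ (L + L)           ≡⟨ cong (λ x → 4 * 2 ^ (L + x)) (+-identityʳ L) ⟨
    4 * 2 ^ t                   ∎

  bound : ∃[ D ] ∃[ E ] Dominating {k} (D ++ˡ E) ×
            q * length D ≤ 2 ^ k × length E * 2 ^ t ≤ q * 2 ^ k →
          k * wsat (k + s) k ≤ 16 * (L * 2 ^ k)
  bound (D , E , dom , D≤ , E≤) = begin
    k * wsat (k + s) k
      ≤⟨ *-monoʳ-≤ k (wsat-≤ dom s) ⟩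
    k * (length (D ++ˡ E) + length (D ++ˡ E))
      ≡⟨ cong (λ x → k * (x + x)) (length-++ D) ⟩
    k * (d + e + (d + e))
      ≡⟨ solve 3 (λ k d e → k :* (d :+ e :+ (d :+ e)) := con 2 :* (k :* d :+ k :* e)) refl k d e ⟩
    2 * (k * d + k * e)
      ≤⟨ *-monoʳ-≤ 2 (+-mono-≤ kd≤ ke≤) ⟩
    2 * (4 * (L * 2 ^ k) + 4 * (L * 2 ^ k))
      ≡⟨ solve 1 (λ x → con 2 :* (con 4 :* x :+ con 4 :* x) := con 16 :* x) refl (L * 2 ^ k) ⟩
    16 * (L * 2 ^ k) ∎
    where
    d = length D
    e = length E
    kd≤ : k * d ≤ 4 * (L * 2 ^ k)
    kd≤ = begin
      k * d                  ≤⟨ *-monoˡ-≤ d k≤4qL ⟩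
      4 * (q * L) * d       ≡⟨ solve 3 (λ q l d → con 4 :* (q :* l) :* d := con 4 :* (l :* (q :* d))) refl q L d ⟩
      4 * (L * (q * d))     ≤⟨ *-monoʳ-≤ 4 (*-monoʳ-≤ L D≤) ⟩
      4 * (L * 2 ^ k)       ∎
    ke≤ : k * e ≤ 4 * (L * 2 ^ k)
    ke≤ = *-cancelˡ-≤ k (begin
      k * (k * e)            ≡⟨ *-assoc k k e ⟨
      k * k * e              ≤⟨ *-monoˡ-≤ e k²≤4*2^t ⟩
      4 * 2 ^ t * e          ≡⟨ solve 2 (λ p e → con 4 :* p :* e := con 4 :* (e :* p)) refl (2 ^ t) e ⟩
      4 * (e * 2 ^ t)        ≤⟨ *-monoʳ-≤ 4 E≤ ⟩
      -- The crude bounds `q ≤ k` and `1 ≤ L` give `E` the same bound as `D`.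
      4 * (q * 2 ^ k)        ≤⟨ *-monoʳ-≤ 4 (*-mono-≤ (m/n≤m k t) (m≤n*m (2 ^ k) L {{>-nonZero 1≤L}})) ⟩
      4 * (k * (L * 2 ^ k)) ≡⟨ solve 2 (λ k x → con 4 :* (k :* x) := k :* (con 4 :* x)) refl k (L * 2 ^ k) ⟩
      k * (4 * (L * 2 ^ k)) ∎)

theorem2 : (∀ k n → 6 ≤ k → k ≤ n → 16 * sat k k ≤ 15 * 2 ^ (k ∸ 1))
    × (∃[ C ] ∀ k n → 6 ≤ k → k ≤ n → k * wsat n k ≤ C * (⌊log₂ k ⌋ * 2 ^ k))
theorem2 =
  (λ k n 6≤k _ → sat-diagonal-≤ 6≤k) ,
  16 , λ k n 6≤k k≤n → subst (λ n → k * wsat n k ≤ 16 * (⌊log₂ k ⌋ * 2 ^ k))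
    (m+[n∸m]≡n k≤n) (wsat-bound k (n ∸ k) 6≤k)
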